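{- Consider the following fenced version of Simpson's 4 slot algorithm, executed under the PSO memory model, with the Writer and the Reader running in parallel from the initial state $reading=\mathsf{false}$, $latest=\mathsf{false}$, $index[\mathsf{false}]=index[\mathsf{true}]=\mathsf{false}$, all four $slot[i][j]$ holding the initial datum $D^0$, and all buffers empty. Writer, invocation $k=1,2,\dots$ (an infinite loop): (P$_1$) $fwp:=\neg reading$; (Q$_1$) $fwindex:=\neg index[fwp]$; (R$_1$) $slot[fwp][fwindex]:=D^k$; $\mathbf{fence}$; (S$_1$) $index[fwp]:=fwindex$; $\mathbf{fence}$; (T$_1$) $latest:=fwp$. Reader, invocation $r=1,2,\dots$ (an infinite loop): (P$_2$) $srp:=latest$; (Q$_2$) $reading:=srp$; $\mathbf{fence}$; (R$_2$) $srindex:=index[srp]$; (S$_2$) read the datum in $slot[srp][srindex]$. Then the three fence instructions shown (two in the Writer, between R$_1$ and S$_1$ and between S$_1$ and T$_1$; one in the Reader, between Q$_2$ and R$_2$) suffice for both of the following properties to hold in every execution under PSO. (1) Interference freedom: in every reachable configuration in which the Writer has executed Q$_1$ but not yet R$_1$ of its current invocation and the Reader has executed R$_2$ but not yet S$_2$ of its current invocation, one has $fwp\neq srp$, or $fwp=srp$ and $fwindex\neq srindex$. (2) Consistent reads: if the $i$-th and the $(i+1)$-th invocation of the Reader read at S$_2$ the data $D^{k_1}$ and $D^{k_2}$ respectively, then $k_1\le k_2$.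
   Context: PSO memory model (operational semantics). The shared variables are $reading$, $latest$, $index[0],index[1]$ and the four cells $slot[i][j]$ (Booleans $\mathsf{false},\mathsf{true}$ serve as indices $0,1$); $fwp,fwindex$ are local to the Writer and $srp,srindex$ are local to the Reader. A configuration consists of a global store (a value for each shared variable) and, for each thread, its local store, its remaining program, and a FIFO buffer of pending values for each shared variable. Transitions are interleavings of the following atomic steps: - a write of value $v$ to a shared variable $x$ by thread $t$ enqueues $v$ in $t$'s buffer for $x$; - a read of a shared variable $x$ by thread $t$ returns the most recently enqueued value in $t$'s buffer for $x$ if this buffer is nonempty, and the value of $x$ in the global store otherwise; - flush: nondeterministically, the oldest value is removed from some nonempty buffer (of some thread $t$ for some variable $x$) and stored into $x$ in the global store; - $\mathbf{fence}$ in thread $t$ can be executed only when all buffers of $t$ are empty, and has no other effect; - purely local computation acts on the local store only. Each assignment listed accesses at most one shared variable. The datum $D^k$ ($k\ge 1$) is the datum written by the $k$-th invocation of the Writer, and $D^0$ is the initial datum; the data are regarded as tagged by their invocation number, so that $D^k\neq D^l$ for $k\neq l$ (the datum read determines which invocation wrote it). -}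

module Defs where

open import Data.Bool.Base using (Bool; true; false; not)
import Data.Bool.Properties as Bool
open import Data.List.Base using (List; []; _∷_; _∷ʳ_; last)
open import Data.List.Membership.Propositional using (_∈_)
open import Data.Maybe.Base using (fromMaybe)
open import Data.Nat.Base using (ℕ; suc)
open import Data.Product.Base using (_×_; _,_; ∃-syntax)
open import Relation.Binary.Definitions using (DecidableEquality)
open import Relation.Binary.PropositionalEquality using (_≡_; refl)
open import Relation.Nullary.Decidable using (yes; no)

update : {A : Set} {B : A → Set} → DecidableEquality A →
         ((a : A) → B a) → (a : A) → B a → (a : A) → B a
update _≟_ f a b a′ with a ≟ a′
... | yes refl = b
... | no _     = f a′

-- An instruction accesses at most one shared variable.  Which one, and the
-- value written, may depend on the local store; the value read is combined
-- with the local store within the same atomic step.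
data Instr (Var : Set) (Val : Var → Set) (L : Set) : Set where
  read   : (x : L → Var) (f : (l : L) → Val (x l) → L) → Instr Var Val L
  write  : (x : L → Var) (e : (l : L) → Val (x l)) → Instr Var Val L
  fence  : Instr Var Val L
  assign : (f : L → L) → Instr Var Val L

-- A thread's remaining program is represented by the label of its next
-- instruction: all programs considered are branch-free, so `next` suffices to
-- describe control flow.
module PSO
  (Thread : Set) (_≟ᵗ_ : DecidableEquality Thread)
  (Var : Set) (_≟ᵛ_ : DecidableEquality Var) (Val : Var → Set)
  (Local : Thread → Set)
  (Label : Thread → Set)
  (instr : (t : Thread) → Label t → Instr Var Val (Local t))
  (next : (t : Thread) → Label t → Label t)
  where

  -- Buffers are kept with the oldest pending value first.
  record Config : Set where
    constructor config
    field
      store  : (x : Var) → Val x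
      local  : (t : Thread) → Local t
      pc     : (t : Thread) → Label t
      buffer : (t : Thread) (x : Var) → List (Val x)

  open Config public

  visible : Config → Thread → (x : Var) → Val x
  visible c t x = fromMaybe (store c x) (last (buffer c t x))

  advance : Config → Thread → (t : Thread) → Label t
  advance c t = update _≟ᵗ_ (pc c) t (next t (pc c t))

  setLocal : Config → (t : Thread) → Local t → (t′ : Thread) → Local t′
  setLocal c = update _≟ᵗ_ (local c)

  setBuffer : Config → (t : Thread) (x : Var) → List (Val x) →
              (t′ : Thread) (x′ : Var) → List (Val x′)
  setBuffer c t x vs = update _≟ᵗ_ (buffer c) t (update _≟ᵛ_ (buffer c t) x vs)

  data Event : Set where
    readᵉ   : (t : Thread) → Label t → (x : Var) → Val x → Event
    writeᵉ  : (t : Thread) → Label t → (x : Var) → Val x → Event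
    fenceᵉ  : (t : Thread) → Label t → Event
    assignᵉ : (t : Thread) → Label t → Event
    flushᵉ  : Thread → (x : Var) → Val x → Event

  data _─[_]→_ (c : Config) : Event → Config → Set where

    read-step : ∀ t {x f} → instr t (pc c t) ≡ read x f →
      let y = x (local c t) ; v = visible c t y in
      c ─[ readᵉ t (pc c t) y v ]→
      record c { local = setLocal c t (f (local c t) v) ; pc = advance c t }

    write-step : ∀ t {x e} → instr t (pc c t) ≡ write x e →
      let y = x (local c t) ; v = e (local c t) in
      c ─[ writeᵉ t (pc c t) y v ]→
      record c { buffer = setBuffer c t y (buffer c t y ∷ʳ v) ; pc = advance c t }

    fence-step : ∀ t → instr t (pc c t) ≡ fence →
      (∀ x → buffer c t x ≡ []) →
      c ─[ fenceᵉ t (pc c t) ]→ record c { pc = advance c t }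

    assign-step : ∀ t {f} → instr t (pc c t) ≡ assign f →
      c ─[ assignᵉ t (pc c t) ]→
      record c { local = setLocal c t (f (local c t)) ; pc = advance c t }

    flush-step : ∀ t x {v vs} → buffer c t x ≡ v ∷ vs →
      c ─[ flushᵉ t x v ]→
      record c { store = update _≟ᵛ_ (store c) x v ; buffer = setBuffer c t x vs }

  infixl 5 _▷_

  -- Finite executions from an initial configuration, indexed by their trace
  -- (newest event first) and their final configuration.
  data Execution (init : Config) : List Event → Config → Set where
    start : Execution init [] init
    _▷_   : ∀ {tr c ev c′} → Execution init tr c → c ─[ ev ]→ c′ →
            Execution init (ev ∷ tr) c′

  Reachable : Config → Config → Set
  Reachable init c = ∃[ tr ] Execution init tr c

data Thread : Set where
  writer reader : Thread

_≟ᵗ_ : DecidableEquality Thread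
writer ≟ᵗ writer = yes refl
writer ≟ᵗ reader = no λ ()
reader ≟ᵗ writer = no λ ()
reader ≟ᵗ reader = yes refl

data Var : Set where
  reading latest : Var
  index          : Bool → Var
  slot           : Bool → Bool → Var

_≟ᵛ_ : DecidableEquality Var
reading ≟ᵛ reading = yes refl
reading ≟ᵛ latest = no λ ()
reading ≟ᵛ index _ = no λ ()
reading ≟ᵛ slot _ _ = no λ ()
latest ≟ᵛ reading = no λ ()
latest ≟ᵛ latest = yes refl
latest ≟ᵛ index _ = no λ ()
latest ≟ᵛ slot _ _ = no λ ()
index _ ≟ᵛ reading = no λ ()
index _ ≟ᵛ latest = no λ ()
index i ≟ᵛ index i′ with i Bool.≟ i′
... | yes refl = yes refl
... | no i≢i′  = no λ { refl → i≢i′ refl }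
index _ ≟ᵛ slot _ _ = no λ ()
slot _ _ ≟ᵛ reading = no λ ()
slot _ _ ≟ᵛ latest = no λ ()
slot _ _ ≟ᵛ index _ = no λ ()
slot i j ≟ᵛ slot i′ j′ with i Bool.≟ i′ | j Bool.≟ j′
... | yes refl | yes refl = yes refl
... | no i≢i′  | _        = no λ { refl → i≢i′ refl }
... | yes _    | no j≢j′  = no λ { refl → j≢j′ refl }

record WriterLocal : Set where
  field
    fwp fwindex : Bool

record ReaderLocal : Set where
  field
    srp srindex : Bool

open WriterLocal public
open ReaderLocal public

Local : Thread → Set
Local writer = WriterLocal
Local reader = ReaderLocal

data WriterPoint : Set where
  P₁ Q₁ R₁ fence-R₁S₁ S₁ fence-S₁T₁ T₁ : WriterPoint

data ReaderPoint : Set where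
  P₂ Q₂ fence-Q₂R₂ R₂ S₂ : ReaderPoint

Point : Thread → Set
Point writer = WriterPoint
Point reader = ReaderPoint

-- The infinite loops are unrolled: (k , p) is point p of the k-th invocation.
Label : Thread → Set
Label t = ℕ × Point t

next : (t : Thread) → Label t → Label t
next writer (k , P₁)         = k , Q₁
next writer (k , Q₁)         = k , R₁
next writer (k , R₁)         = k , fence-R₁S₁
next writer (k , fence-R₁S₁) = k , S₁
next writer (k , S₁)         = k , fence-S₁T₁
next writer (k , fence-S₁T₁) = k , T₁
next writer (k , T₁)         = suc k , P₁
next reader (r , P₂)         = r , Q₂
next reader (r , Q₂)         = r , fence-Q₂R₂
next reader (r , fence-Q₂R₂) = r , R₂
next reader (r , R₂)         = r , S₂
next reader (r , S₂)         = suc r , P₂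

module Simpson (Datum : Set) (D : ℕ → Datum) where

  Val : Var → Set
  Val reading    = Bool
  Val latest     = Bool
  Val (index _)  = Bool
  Val (slot _ _) = Datum

  -- The datum read at S₂ is not kept in the local store; it is recorded in the
  -- event of that step.
  instr : (t : Thread) → Label t → Instr Var Val (Local t)
  instr writer (k , P₁) = read (λ _ → reading) (λ l v → record l { fwp = not v })
  instr writer (k , Q₁) = read (λ l → index (fwp l)) (λ l v → record l { fwindex = not v })
  instr writer (k , R₁) = write (λ l → slot (fwp l) (fwindex l)) (λ _ → D k)
  instr writer (k , fence-R₁S₁) = fence
  instr writer (k , S₁) = write (λ l → index (fwp l)) (λ l → fwindex l)
  instr writer (k , fence-S₁T₁) = fence
  instr writer (k , T₁) = write (λ _ → latest) (λ l → fwp l)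
  instr reader (r , P₂) = read (λ _ → latest) (λ l v → record l { srp = v })
  instr reader (r , Q₂) = write (λ _ → reading) (λ l → srp l)
  instr reader (r , fence-Q₂R₂) = fence
  instr reader (r , R₂) = read (λ l → index (srp l)) (λ l v → record l { srindex = v })
  instr reader (r , S₂) = read (λ l → slot (srp l) (srindex l)) (λ l _ → l)

  open PSO Thread _≟ᵗ_ Var _≟ᵛ_ Val Local Label instr next public

  initialStore : (x : Var) → Val x
  initialStore reading    = false
  initialStore latest     = false
  initialStore (index _)  = false
  initialStore (slot _ _) = D 0

  initialLocal : WriterLocal → ReaderLocal → (t : Thread) → Local t
  initialLocal w r writer = w
  initialLocal w r reader = r

  initialLabel : (t : Thread) → Label t
  initialLabel writer = 1 , P₁
  initialLabel reader = 1 , P₂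

  -- The initial values of the local variables are unconstrained.
  initial : WriterLocal → ReaderLocal → Config
  initial w r = record
    { store  = initialStore
    ; local  = initialLocal w r
    ; pc     = initialLabel
    ; buffer = λ _ _ → []
    }

  InvocationReads : List Event → ℕ → Datum → Set
  InvocationReads tr i d = ∃[ a ] ∃[ b ] readᵉ reader (i , S₂) (slot a b) d ∈ tr

{-# OPTIONS --safe #-}

-- Call a value of `latest` upcoming if the Writer has buffered it or holds it in
-- fwp.  The fences allow at most two upcoming values, and whenever one of them
-- differs from `latest`, then `reading` equals `latest`: the Writer chooses
-- ¬ reading, and a Reader about to overwrite `reading` with a stale value of
-- `latest` finds that stale value there already.
--
-- For a pair b let published b be the invocation that wrote slot[b][index[b]].
-- It can be larger for ¬ latest than for latest only while ¬ latest is upcoming,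
-- and then a Reader about to read index[srp] has srp = reading = latest.  So what
-- the Reader finds there is never newer than what the next invocation will find
-- through latest, which gives consistent reads.  Between R₂ and S₂ the Writer may
-- change index[srp] once, but its next invocation chooses ¬ srp, which gives
-- interference freedom.
module Submission where

open import Defs
open import Data.Bool.Base using (Bool; not; if_then_else_)
import Data.Bool.Properties as Bool
open import Data.Empty using (⊥; ⊥-elim)
open import Data.List.Base using (List; []; _∷_; _∷ʳ_; fromMaybe)
open import Data.List.Relation.Unary.Any using (here; there)
open import Data.Maybe.Base using (Maybe; just; nothing)
open import Data.Maybe.Properties using (just-injective)
open import Data.Nat.Base using (ℕ; suc; _≤_; _<_; z≤n)
open import Data.Nat.Properties using
  (≤-refl; ≤-reflexive; ≤-trans; <⇒≤; <-irrefl; 1+n≰n; n<1+n; m≤n⇒m≤1+n; m<n⇒m<1+n; suc-injective)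
open import Data.Product.Base using (_×_; _,_; proj₂; ∃-syntax)
open import Data.Sum.Base using (_⊎_; inj₁; inj₂; map₁; map₂)
open import Data.Unit.Base using (⊤; tt)
open import Function.Definitions using (Injective)
open import Relation.Binary.PropositionalEquality
  using (_≡_; _≢_; refl; sym; trans; cong; cong₂; subst; subst₂)
open import Relation.Nullary.Decidable using (yes; no; does; dec-true; dec-false)

-- Abstract states and their invariant.

-- The Writer and Reader points, refined at each fence by whether the preceding
-- write is still buffered.
data WriterPhase : Set where
  P₁ Q₁ R₁ slotBuffered slotStored S₁ indexBuffered indexStored T₁ : WriterPhase

data ReaderPhase : Set where
  P₂ Q₂ readingBuffered readingStored R₂ S₂ : ReaderPhase

-- `rd`, `la` and `ix` are the stored values of `reading`, `latest` and `index`;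
-- `stamp i j` is the invocation whose datum is stored in `slot i j`; `buffered` is
-- the buffered value of `latest`; `n` is the number of the datum last read.
record State : Set where
  field
    rd la    : Bool
    ix       : Bool → Bool
    stamp    : Bool → Bool → ℕ
    k        : ℕ
    w        : WriterPhase
    buffered : Maybe Bool
    wl       : WriterLocal
    r        : ReaderPhase
    rl       : ReaderLocal
    n        : ℕ

-- At `P₁` the value of `fwp` is left over from the previous invocation, or arbitrary at the start.
Chosen : WriterPhase → Set
Chosen P₁ = ⊥
Chosen _  = ⊤

-- Reaches beyond `R₁`: the slot write may enter the store later, and must still miss the slot that
-- a Reader at `S₂` has selected.
Unpublished : WriterPhase → Set
Unpublished P₁          = ⊥
Unpublished indexStored = ⊥
Unpublished T₁          = ⊥
Unpublished _           = ⊤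

-- The phases from the first Writer fence up to `T₁`: that fence empties the buffer of `latest`
-- along with that of the slot.
Drained : WriterPhase → Set
Drained S₁            = ⊤
Drained indexBuffered = ⊤
Drained indexStored   = ⊤
Drained T₁            = ⊤
Drained _             = ⊥

Progress : (Bool → Bool) → (Bool → Bool → ℕ) → ℕ → WriterLocal → WriterPhase → Set
Progress ix stamp k l = go
  where
  FreshIndex Stored Published : Set
  FreshIndex = fwindex l ≡ not (ix (fwp l))
  Stored     = stamp (fwp l) (fwindex l) ≡ k
  Published  = stamp (fwp l) (ix (fwp l)) ≡ k

  go : WriterPhase → Set
  go P₁            = ⊤
  go Q₁            = ⊤
  go R₁            = FreshIndex
  go slotBuffered  = FreshIndex
  go slotStored    = FreshIndex × Stored
  go S₁            = FreshIndex × Stored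
  go indexBuffered = FreshIndex × Stored
  go indexStored   = Published
  go T₁            = Published

Announced : ReaderPhase → Set
Announced P₂ = ⊥
Announced _  = ⊤

Synced : ReaderPhase → Set
Synced readingStored = ⊤
Synced R₂            = ⊤
Synced S₂            = ⊤
Synced _             = ⊥

-- A lower bound for the number of the datum that the Reader reads next.
floor : (Bool → Bool) → (Bool → Bool → ℕ) → Bool → ReaderLocal → ReaderPhase → ℕ
floor ix stamp la l P₂ = stamp la (ix la)
floor ix stamp la l S₂ = stamp (srp l) (srindex l)
floor ix stamp la l _  = stamp (srp l) (ix (srp l))

module _ (s : State) where
  open State s

  published : Bool → ℕ
  published b = stamp b (ix b)

  Upcoming : Bool → Set
  Upcoming b = buffered ≡ just b ⊎ (Chosen w × fwp wl ≡ b)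

  -- Interference freedom is read off `progress` and `disjoint`, consistent reads off `above`. The
  -- other fields make these inductive.
  record Safe : Set where
    field
      bounded   : ∀ b → published b ≤ k
      progress  : Progress ix stamp k wl w
      drained   : Drained w → buffered ≡ nothing
      newest    : ∀ {b} → buffered ≡ just b → published (not b) ≤ published b
      lag       : published (not la) ≤ published la ⊎ Upcoming (not la)
      held      : Upcoming (not la) → rd ≡ la
      aligned   : buffered ≡ just (not la) → Chosen w → fwp wl ≡ not la
      -- Used for its contrapositive as well: a stale `srp`, different from `la`, is already the
      -- value of `reading`.
      announced : Announced r → rd ≡ la → srp rl ≡ la
      synced    : Synced r → rd ≡ srp rl
      above     : n ≤ floor ix stamp la rl r
      settled   : r ≡ S₂ → stamp (srp rl) (srindex rl) ≤ published la
      disjoint  : r ≡ S₂ → Unpublished w → fwp wl ≡ srp rl → srindex rl ≡ ix (srp rl)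

-- One hypothesis per kind of clause of `floor`. The last is restricted to `S₂`, since before `R₂`
-- the value of `srindex` is stale and may name a slot being overwritten.
floor-mono : ∀ {ix ix′ stamp stamp′ la la′ l} r →
  stamp la (ix la) ≤ stamp′ la′ (ix′ la′) →
  (∀ b → stamp b (ix b) ≤ stamp′ b (ix′ b)) →
  (r ≡ S₂ → stamp (srp l) (srindex l) ≤ stamp′ (srp l) (srindex l)) →
  floor ix stamp la l r ≤ floor ix′ stamp′ la′ l r
floor-mono P₂              la≤ ≤′ S₂≤ = la≤
floor-mono Q₂              la≤ ≤′ S₂≤ = ≤′ _
floor-mono readingBuffered la≤ ≤′ S₂≤ = ≤′ _
floor-mono readingStored   la≤ ≤′ S₂≤ = ≤′ _
floor-mono R₂              la≤ ≤′ S₂≤ = ≤′ _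
floor-mono S₂              la≤ ≤′ S₂≤ = S₂≤ refl

-- Preservation of the invariant: Writer steps and flushes.

module _ (s : State) where
  open State s

  -- Choosing `not rd` makes `not la` upcoming only when `rd ≡ la`. It also avoids the pair of a
  -- Reader at `S₂`, whose `srp` is in `reading` by `synced`.
  safe-P₁ : Safe (record s { w = P₁ }) →
    Safe (record s { w = Q₁ ; wl = record wl { fwp = not rd } })
  safe-P₁ σ = record
    { Safe σ
    ; lag      = map₂ (λ { (inj₁ e) → inj₁ e }) lag
    ; held     = λ { (inj₁ e) → held (inj₁ e) ; (inj₂ (_ , e)) → Bool.not-injective e }
    ; aligned  = λ e _ → cong not (held (inj₁ e))
    ; disjoint = λ { refl _ e → ⊥-elim (Bool.not-¬ (sym (synced tt)) (sym e)) }
    }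
    where open Safe σ

  safe-Q₁ : Safe (record s { w = Q₁ }) →
    Safe (record s { w = R₁ ; wl = record wl { fwindex = not (ix (fwp wl)) } })
  safe-Q₁ σ = record { Safe σ ; progress = refl }

  safe-R₁ : Safe (record s { w = R₁ }) → Safe (record s { w = slotBuffered })
  safe-R₁ σ = record { Safe σ }

  safe-fence-R₁S₁ : Safe (record s { w = slotStored ; buffered = nothing }) →
    Safe (record s { w = S₁ ; buffered = nothing })
  safe-fence-R₁S₁ σ = record { Safe σ ; drained = λ _ → refl }

  safe-S₁ : Safe (record s { w = S₁ }) → Safe (record s { w = indexBuffered })
  safe-S₁ σ = record { Safe σ }

  safe-fence-S₁T₁ : Safe (record s { w = indexStored }) → Safe (record s { w = T₁ })
  safe-fence-S₁T₁ σ = record { Safe σ }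

  -- `fwp` stays upcoming, now as the buffered value. Its pair publishes the old `k`, which bounds
  -- both pairs; this gives `newest`.
  safe-T₁ : Safe (record s { w = T₁ ; buffered = nothing }) →
    Safe (record s { w = P₁ ; buffered = just (fwp wl) ; k = suc k })
  safe-T₁ σ = record
    { Safe σ
    ; bounded  = λ b → m≤n⇒m≤1+n (bounded b)
    ; progress = tt
    ; drained  = λ ()
    ; newest   = λ { refl → ≤-trans (bounded _) (≤-reflexive (sym progress)) }
    ; lag      = map₂ (λ { (inj₂ (_ , e)) → inj₁ (cong just e) }) lag
    ; held     = λ { (inj₁ e) → held (inj₂ (tt , just-injective e)) }
    ; aligned  = λ _ ()
    ; disjoint = λ _ ()
    }
    where open Safe σ

  -- `fwindex` negates the current index of its pair, so the overwritten slot is not a published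
  -- one. By `disjoint` it is not the one that a Reader at `S₂` is about to read either.
  safe-flush-slot : ∀ {stamp′} → stamp′ (fwp wl) (fwindex wl) ≡ k →
    (∀ i j → slot (fwp wl) (fwindex wl) ≢ slot i j → stamp′ i j ≡ stamp i j) →
    Safe (record s { w = slotBuffered }) →
    Safe (record s { w = slotStored ; stamp = stamp′ })
  safe-flush-slot {stamp′} at elsewhere σ = record
    { Safe σ
    ; bounded  = λ b → subst (_≤ k) (unchanged b) (bounded b)
    ; progress = progress , at
    ; newest   = λ {b} e → subst₂ _≤_ (unchanged (not b)) (unchanged b) (newest e)
    ; lag      = map₁ (subst₂ _≤_ (unchanged (not la)) (unchanged la)) lag
    ; above    = ≤-trans above (floor-mono r (≤-reflexive (unchanged la))
                   (λ b → ≤-reflexive (unchanged b)) (λ e → ≤-reflexive (unread e)))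
    ; settled  = λ e → subst₂ _≤_ (unread e) (unchanged la) (settled e)
    }
    where
    open Safe σ
    unchanged : ∀ b → stamp b (ix b) ≡ stamp′ b (ix b)
    unchanged b = sym (elsewhere b (ix b) λ { refl → Bool.not-¬ refl progress })
    unread : r ≡ S₂ → stamp (srp rl) (srindex rl) ≡ stamp′ (srp rl) (srindex rl)
    unread e = sym (elsewhere _ _ λ eq → clash eq (disjoint e tt))
      where
      clash : ∀ {i j} → slot (fwp wl) (fwindex wl) ≡ slot i j →
        (fwp wl ≡ i → j ≡ ix i) → ⊥
      clash refl h = Bool.not-¬ (h refl) progress

  -- The newly exposed slot carries `k`, an upper bound of `published`, so `published` can only
  -- grow.
  safe-flush-index : ∀ {ix′} → ix′ (fwp wl) ≡ fwindex wl →
    (∀ b → index (fwp wl) ≢ index b → ix′ b ≡ ix b) →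
    Safe (record s { w = indexBuffered }) →
    Safe (record s { w = indexStored ; ix = ix′ })
  safe-flush-index {ix′} at elsewhere σ = record
    { Safe σ
    ; bounded  = bounded′
    ; progress = now
    -- Vacuous thanks to the first Writer fence: a `latest` still pending for the other pair would
    -- now be overtaken.
    ; newest   = λ e → ⊥-elim (nothing≢just (trans (sym (drained tt)) e))
    ; lag      = lag′
    ; above    = ≤-trans above (floor-mono r (grows la) grows (λ _ → ≤-refl))
    ; settled  = λ e → ≤-trans (settled e) (grows la)
    ; disjoint = λ _ ()
    }
    where
    open Safe σ
    nothing≢just : ∀ {b : Bool} → nothing ≢ just b
    nothing≢just ()
    now : stamp (fwp wl) (ix′ (fwp wl)) ≡ k
    now = trans (cong (stamp (fwp wl)) at) (proj₂ progress)
    bounded′ : ∀ b → stamp b (ix′ b) ≤ k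
    bounded′ b with fwp wl Bool.≟ b
    ... | yes refl = ≤-reflexive now
    ... | no p≢b   = subst (λ j → stamp b j ≤ k)
                       (sym (elsewhere b λ { refl → p≢b refl })) (bounded b)
    grows : ∀ b → stamp b (ix b) ≤ stamp b (ix′ b)
    grows b with fwp wl Bool.≟ b
    ... | yes refl = subst (stamp b (ix b) ≤_) (sym now) (bounded b)
    ... | no p≢b   = ≤-reflexive (cong (stamp b) (sym (elsewhere b λ { refl → p≢b refl })))
    lag′ : stamp (not la) (ix′ (not la)) ≤ stamp la (ix′ la) ⊎ _
    -- Either the pair of `la` itself receives the maximal number, or the other pair does and is
    -- upcoming through `fwp`.
    lag′ with fwp wl Bool.≟ la
    ... | yes refl = inj₁ (subst (_ ≤_) (sym now) (bounded′ _))
    ... | no p≢la  = inj₂ (inj₂ (tt , Bool.¬-not p≢la))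

  -- The case of interest is `b` different from `la`. Then `held` says that `reading` is the old
  -- `la`, and `aligned` says that a chosen `fwp` equals `b`, so `not b` is not upcoming afterwards.
  safe-flush-latest : ∀ {b} → Safe (record s { buffered = just b }) →
    Safe (record s { buffered = nothing ; la = b })
  safe-flush-latest {b} σ = record
    { Safe σ
    ; drained   = λ _ → refl
    ; newest    = λ ()
    ; lag       = inj₁ (newest refl)
    ; held      = λ { (inj₂ (c , e)) → held′ c e }
    ; aligned   = λ ()
    ; announced = announced′
    ; above     = ≤-trans above (floor-mono r grows (λ _ → ≤-refl) (λ _ → ≤-refl))
    ; settled   = λ e → ≤-trans (settled e) grows
    }
    where
    open Safe σ
    held′ : Chosen w → fwp wl ≡ not b → rd ≡ b
    held′ c e with b Bool.≟ la
    ... | yes refl = held (inj₂ (c , e))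
    ... | no b≢la  = ⊥-elim (Bool.not-¬ {b} refl (trans (Bool.¬-not b≢la)
                       (trans (sym (aligned (cong just (Bool.¬-not b≢la)) c)) e)))
    announced′ : Announced r → rd ≡ b → srp rl ≡ b
    announced′ a e with b Bool.≟ la
    ... | yes refl = announced a e
    ... | no b≢la  = ⊥-elim (b≢la (trans (sym e) (held (inj₁ (cong just (Bool.¬-not b≢la))))))
    grows : stamp la (ix la) ≤ stamp b (ix b)
    grows with la Bool.≟ b
    ... | yes refl = ≤-refl
    ... | no la≢b  = subst (λ a → stamp a (ix a) ≤ _) (sym (Bool.¬-not la≢b)) (newest refl)

  -- Preservation of the invariant: Reader steps and flushes.

  safe-P₂ : Safe (record s { r = P₂ }) →
    Safe (record s { r = Q₂ ; rl = record rl { srp = la } })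
  safe-P₂ σ = record
    { Safe σ ; announced = λ _ _ → refl ; synced = λ () ; settled = λ () ; disjoint = λ () }

  safe-Q₂ : Safe (record s { r = Q₂ }) → Safe (record s { r = readingBuffered })
  safe-Q₂ σ = record { Safe σ ; settled = λ () ; disjoint = λ () }

  -- If `not la` is upcoming, `held` gives `rd ≡ la`, which `announced` turns into `srp ≡ la`; the
  -- flush then leaves `reading` as it was.
  safe-flush-reading : Safe (record s { r = readingBuffered }) →
    Safe (record s { r = readingStored ; rd = srp rl })
  safe-flush-reading σ = record
    { Safe σ
    ; held      = λ u → announced tt (held u)
    ; announced = λ _ e → e
    ; synced    = λ _ → refl
    ; settled   = λ ()
    ; disjoint  = λ ()
    }
    where open Safe σ

  safe-fence-Q₂R₂ : Safe (record s { r = readingStored }) → Safe (record s { r = R₂ })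
  safe-fence-Q₂R₂ σ = record { Safe σ ; settled = λ () ; disjoint = λ () }

  safe-R₂ : Safe (record s { r = R₂ }) →
    Safe (record s { r = S₂ ; rl = record rl { srindex = ix (srp rl) } })
  safe-R₂ σ = record { Safe σ ; settled = λ _ → settled′ ; disjoint = λ _ _ _ → refl }
    where
    open Safe σ
    settled′ : stamp (srp rl) (ix (srp rl)) ≤ stamp la (ix la)
    settled′ with srp rl Bool.≟ la | lag
    ... | yes refl  | _      = ≤-refl
    ... | no srp≢la | inj₁ h = subst (λ a → stamp a (ix a) ≤ _) (sym (Bool.¬-not srp≢la)) h
    -- An upcoming `not la` forces `reading` to be `la`, while after the Reader's fence it is `srp`.
    ... | no srp≢la | inj₂ u = ⊥-elim (srp≢la (trans (sym (synced tt)) (held u)))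

  safe-S₂ : Safe (record s { r = S₂ }) →
    Safe (record s { r = P₂ ; n = stamp (srp rl) (srindex rl) })
  safe-S₂ σ = record
    { Safe σ
    ; announced = λ ()
    ; synced    = λ ()
    -- The slot just read is no newer than what `latest` leads to, and that is the floor at `P₂`.
    ; above     = settled refl
    ; settled   = λ ()
    ; disjoint  = λ ()
    }
    where open Safe σ

-- Configurations as abstract states: buffers and ghost data.

module Simulation {Datum : Set} (D : ℕ → Datum) where

  open Simpson Datum D

  writerPoint : WriterPhase → WriterPoint
  writerPoint P₁            = P₁
  writerPoint Q₁            = Q₁
  writerPoint R₁            = R₁
  writerPoint slotBuffered  = fence-R₁S₁
  writerPoint slotStored    = fence-R₁S₁
  writerPoint S₁            = S₁
  writerPoint indexBuffered = fence-S₁T₁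
  writerPoint indexStored   = fence-S₁T₁
  writerPoint T₁            = T₁

  readerPoint : ReaderPhase → ReaderPoint
  readerPoint P₂              = P₂
  readerPoint Q₂              = Q₂
  readerPoint readingBuffered = fence-Q₂R₂
  readerPoint readingStored   = fence-Q₂R₂
  readerPoint R₂              = R₂
  readerPoint S₂              = S₂

  only : (x : Var) → Val x → (y : Var) → List (Val y)
  only x v = update _≟ᵛ_ (λ _ → []) x (v ∷ [])

  pendingWrite : ℕ → WriterLocal → WriterPhase → Maybe (∃[ x ] Val x)
  pendingWrite k l slotBuffered  = just (slot (fwp l) (fwindex l) , D k)
  pendingWrite k l indexBuffered = just (index (fwp l) , fwindex l)
  pendingWrite k l _             = nothing

  -- `latest` is kept apart because its value from the previous invocation can be pending together
  -- with the current slot write, and PSO may flush the two in either order. Apart from it at most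
  -- one write is pending.
  writerBuffer : Maybe Bool → Maybe (∃[ x ] Val x) → (x : Var) → List (Val x)
  writerBuffer m o              latest = fromMaybe m
  writerBuffer m nothing        _      = []
  writerBuffer m (just (y , v)) x      = only y v x

  readerBuffer : ReaderLocal → ReaderPhase → (x : Var) → List (Val x)
  readerBuffer l readingBuffered x = only reading (srp l) x
  readerBuffer l _               _ = []

  record Ghost : Set where
    field
      k i n    : ℕ
      w        : WriterPhase
      r        : ReaderPhase
      buffered : Maybe Bool
      stamp    : Bool → Bool → ℕ

  state : Config → Ghost → State
  state c g = record
    { Ghost g
    ; rd = store c reading
    ; la = store c latest
    ; ix = λ b → store c (index b)
    ; wl = local c writer
    ; rl = local c reader
    }

  record Represents (c : Config) (g : Ghost) : Set where
    open Ghost g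
    field
      writer-pc     : pc c writer ≡ (k , writerPoint w)
      reader-pc     : pc c reader ≡ (i , readerPoint r)
      writer-buffer : ∀ x → buffer c writer x ≡ 
                      writerBuffer buffered (pendingWrite k (local c writer) w) x
      reader-buffer : ∀ x → buffer c reader x ≡ readerBuffer (local c reader) r x
      stamped       : ∀ a b → store c (slot a b) ≡ D (stamp a b)

  -- Bookkeeping of the Reader's past reads.

  -- Only the last datum number `n` is remembered, since `ordered` compares consecutive invocations.
  record History (tr : List Event) (i n : ℕ) : Set where
    field
      past    : ∀ {j d} → InvocationReads tr j d → j < i
      recent  : ∀ {j d} → InvocationReads tr j d → suc j ≡ i → d ≡ D n
      ordered : ∀ {j k₁ k₂} → InvocationReads tr j (D k₁) →
                InvocationReads tr (suc j) (D k₂) → k₁ ≤ k₂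

  slotRead : Event → Maybe (Label reader × Datum)
  slotRead (readᵉ reader l (slot _ _) d) = just (l , d)
  slotRead _                             = nothing

  earlier-read : ∀ {tr ev j d} → slotRead ev ≡ nothing →
    InvocationReads (ev ∷ tr) j d → InvocationReads tr j d
  earlier-read none (a , b , there p)   = a , b , p
  earlier-read ()   (a , b , here refl)

  history-skip : ∀ {tr ev i n} → slotRead ev ≡ nothing → History tr i n → History (ev ∷ tr) i n
  history-skip none η = record
    { past    = λ p → past (earlier-read none p)
    ; recent  = λ p → recent (earlier-read none p)
    ; ordered = λ p₁ p₂ → ordered (earlier-read none p₁) (earlier-read none p₂)
    }
    where open History η

  earlier-or-now : ∀ {tr ev i d j d′} → slotRead ev ≡ just ((i , S₂) , d) →
    InvocationReads (ev ∷ tr) j d′ → InvocationReads tr j d′ ⊎ (j ≡ i × d′ ≡ d)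
  earlier-or-now now  (a , b , there p)   = inj₁ (a , b , p)
  earlier-or-now refl (a , b , here refl) = inj₂ (refl , refl)

  history-read : Injective _≡_ _≡_ D → ∀ {tr ev i n m} →
    slotRead ev ≡ just ((i , S₂) , D m) → n ≤ m → History tr i n → History (ev ∷ tr) (suc i) m
  history-read D-inj {tr} {ev} {i} {n} {m} now n≤m η = record
    { past = past′ ; recent = recent′ ; ordered = ordered′ }
    where
    open History η
    past′ : ∀ {j d} → InvocationReads (ev ∷ tr) j d → j < suc i
    past′ p with earlier-or-now now p
    ... | inj₁ q          = m<n⇒m<1+n (past q)
    ... | inj₂ (refl , _) = n<1+n i

    recent′ : ∀ {j d} → InvocationReads (ev ∷ tr) j d → suc j ≡ suc i → d ≡ D m
    recent′ p e with earlier-or-now now p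
    ... | inj₁ q        = ⊥-elim (<-irrefl (suc-injective e) (past q))
    ... | inj₂ (_ , d≡) = d≡

    ordered′ : ∀ {j k₁ k₂} → InvocationReads (ev ∷ tr) j (D k₁) →
      InvocationReads (ev ∷ tr) (suc j) (D k₂) → k₁ ≤ k₂
    ordered′ p₁ p₂ with earlier-or-now now p₁ | earlier-or-now now p₂
    ... | inj₁ q₁         | inj₁ q₂         = ordered q₁ q₂
    ... | inj₁ q₁         | inj₂ (j+1≡i , e) =
      -- The older read is that of the invocation just before `i`, hence returned `D n`; injectivity
      -- of `D` recovers both numbers.
      subst₂ _≤_ (sym (D-inj (recent q₁ j+1≡i))) (sym (D-inj e)) n≤m
    ... | inj₂ (refl , _) | inj₁ q₂         = ⊥-elim (1+n≰n (<⇒≤ (past q₂)))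
    ... | inj₂ (refl , _) | inj₂ (() , _)

  Invariant : List Event → Config → Set
  Invariant tr c =
    ∃[ g ] Represents c g × Safe (state c g) × History tr (Ghost.i g) (Ghost.n g)

  -- Updates of stores and buffers.

  update-at : ∀ {B : Var → Set} {f : (x : Var) → B x} x {b} → update _≟ᵛ_ f x b x ≡ b
  update-at x with x ≟ᵛ x
  ... | yes refl = refl
  ... | no x≢x   = ⊥-elim (x≢x refl)

  only-nonempty : ∀ x {v} → only x v x ≢ []
  only-nonempty x e with () ← trans (sym (update-at x)) e

  update-elsewhere : ∀ {B : Var → Set} {f : (x : Var) → B x} {x b y} → x ≢ y →
    update _≟ᵛ_ f x b y ≡ f y
  update-elsewhere {x = x} {y = y} x≢y with x ≟ᵛ y
  ... | yes x≡y = ⊥-elim (x≢y x≡y)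
  ... | no _    = refl

  update-cong : ∀ {f g : (x : Var) → List (Val x)} x {a b} y → a ≡ b → f y ≡ g y →
    update _≟ᵛ_ f x a y ≡ update _≟ᵛ_ g x b y
  update-cong x y a≡b e with x ≟ᵛ y
  ... | yes refl = a≡b
  ... | no _     = e

  only-drained : ∀ {f : (x : Var) → List (Val x)} x {v} y → f y ≡ only x v y →
    update _≟ᵛ_ f x [] y ≡ []
  only-drained x y e with x ≟ᵛ y | e
  ... | yes refl | _  = refl
  ... | no _     | e′ = e′

  idle-empty : ∀ {m} x → x ≢ latest → writerBuffer m nothing x ≡ []
  idle-empty reading    _        = refl
  idle-empty latest     x≢latest = ⊥-elim (x≢latest refl)
  idle-empty (index _)  _        = refl
  idle-empty (slot _ _) _        = refl

  -- The buffer of `y` was empty, so appending yields a singleton. The split on `x` lets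
  -- `writerBuffer` reduce.
  enqueue : ∀ {f m} y {v} → y ≢ latest → (∀ x → f x ≡ writerBuffer m nothing x) →
    ∀ x → update _≟ᵛ_ f y (f y ∷ʳ v) x ≡ writerBuffer m (just (y , v)) x
  enqueue {f} {m} y {v} y≢latest e = go
    where
    fy : f y ∷ʳ v ≡ v ∷ []
    fy = cong (_∷ʳ v) (trans (e y) (idle-empty {m} y y≢latest))
    go : ∀ x → _
    go latest       = trans (update-elsewhere y≢latest) (e latest)
    go x@reading    = update-cong y x fy (e x)
    go x@(index _)  = update-cong y x fy (e x)
    go x@(slot _ _) = update-cong y x fy (e x)

  dequeue : ∀ {f m} y {v} → y ≢ latest → (∀ x → f x ≡ writerBuffer m (just (y , v)) x) →
    ∀ x → update _≟ᵛ_ f y [] x ≡ writerBuffer m nothing x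
  dequeue y y≢latest e latest       = trans (update-elsewhere y≢latest) (e latest)
  dequeue y y≢latest e x@reading    = only-drained y x (e x)
  dequeue y y≢latest e x@(index _)  = only-drained y x (e x)
  dequeue y y≢latest e x@(slot _ _) = only-drained y x (e x)

  dequeue-latest : ∀ {f m o} → (∀ x → f x ≡ writerBuffer m o x) →
    ∀ x → update _≟ᵛ_ f latest [] x ≡ writerBuffer nothing o x
  dequeue-latest             e latest       = refl
  dequeue-latest {o = nothing} e x@reading    = e x
  dequeue-latest {o = nothing} e x@(index _)  = e x
  dequeue-latest {o = nothing} e x@(slot _ _) = e x
  dequeue-latest {o = just _}  e x@reading    = e x
  dequeue-latest {o = just _}  e x@(index _)  = e x
  dequeue-latest {o = just _}  e x@(slot _ _) = e x

  -- Phases recovered from pending writes; stamps after a slot write.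

  slot-pending : ∀ {m k l} w {a b v vs} →
    writerBuffer m (pendingWrite k l w) (slot a b) ≡ v ∷ vs → w ≡ slotBuffered
  slot-pending slotBuffered _ = refl

  index-pending : ∀ {m k l} w {b v vs} →
    writerBuffer m (pendingWrite k l w) (index b) ≡ v ∷ vs → w ≡ indexBuffered
  index-pending indexBuffered _ = refl

  reading-unwritten : ∀ {m k l} w {v vs} →
    writerBuffer m (pendingWrite k l w) reading ≢ v ∷ vs
  reading-unwritten P₁ ()

  reader-pending : ∀ {l} r x {v vs} → readerBuffer l r x ≡ v ∷ vs →
    r ≡ readingBuffered × x ≡ reading
  reader-pending readingBuffered reading _ = refl , refl

  writer-assigns-nothing : ∀ {k} w {f} → instr writer (k , writerPoint w) ≢ assign f
  writer-assigns-nothing P₁ ()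

  reader-assigns-nothing : ∀ {i} r {f} → instr reader (i , readerPoint r) ≢ assign f
  reader-assigns-nothing P₂ ()

  -- Branches on the same decision as `update` on the store, so that one case split reduces both
  -- sides of `stamped`.
  restamp : Var → ℕ → (Bool → Bool → ℕ) → Bool → Bool → ℕ
  restamp x k stamp a b = if does (x ≟ᵛ slot a b) then k else stamp a b

  restamp-at : ∀ {k} stamp a b → restamp (slot a b) k stamp a b ≡ k
  restamp-at {k} stamp a b =
    cong (if_then k else stamp a b) (dec-true (slot a b ≟ᵛ slot a b) refl)

  restamp-elsewhere : ∀ {x k stamp} a b → x ≢ slot a b → restamp x k stamp a b ≡ stamp a b
  restamp-elsewhere {x} {k} {stamp} a b x≢ =
    cong (if_then k else stamp a b) (dec-false (x ≟ᵛ slot a b) x≢)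

  -- Simulation of the PSO steps.

  module _ {tr : List Event} {c : Config} where

    -- Applies at every read of either thread: its own buffer for the variable read is empty in that
    -- phase.
    visible-flushed : ∀ t x → buffer c t x ≡ [] → visible c t x ≡ store c x
    visible-flushed t x e rewrite e = refl

    Preserved : Ghost → Event → Config → Set
    Preserved g ev c′ = Represents c g → Safe (state c g) →
      History tr (Ghost.i g) (Ghost.n g) → Invariant (ev ∷ tr) c′

    writer-read : ∀ g {x f} → instr writer (Ghost.k g , writerPoint (Ghost.w g)) ≡ read x f →
      let y = x (local c writer) ; v = visible c writer y in
      Preserved g (readᵉ writer (pc c writer) y v)
        (record c { local = setLocal c writer (f (local c writer) v) ; pc = advance c writer })
    writer-read g@record { w = P₁ } refl ρ σ η
      rewrite visible-flushed writer reading (Represents.writer-buffer ρ reading) =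
      record { Ghost g ; w = Q₁ } ,
      record { Represents ρ ; writer-pc = cong (next writer) (Represents.writer-pc ρ) } ,
      safe-P₁ (state c g) σ , history-skip refl η
    writer-read g@record { w = Q₁ } refl ρ σ η
      rewrite visible-flushed writer (index (fwp (local c writer)))
                (Represents.writer-buffer ρ (index (fwp (local c writer)))) =
      record { Ghost g ; w = R₁ } ,
      record { Represents ρ ; writer-pc = cong (next writer) (Represents.writer-pc ρ) } ,
      safe-Q₁ (state c g) σ , history-skip refl η

    writer-write : ∀ g {x e} → instr writer (Ghost.k g , writerPoint (Ghost.w g)) ≡ write x e →
      let y = x (local c writer) ; v = e (local c writer) in
      Preserved g (writeᵉ writer (pc c writer) y v)
        (record c { buffer = setBuffer c writer y (buffer c writer y ∷ʳ v) ; pc = advance c writer })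
    writer-write g@record { w = R₁ } refl ρ σ η =
      record { Ghost g ; w = slotBuffered } ,
      record { Represents ρ ; writer-pc = cong (next writer) (Represents.writer-pc ρ)
             ; writer-buffer = enqueue (slot _ _) (λ ()) (Represents.writer-buffer ρ) } ,
      safe-R₁ (state c g) σ , history-skip refl η
    writer-write g@record { w = S₁ } refl ρ σ η =
      record { Ghost g ; w = indexBuffered } ,
      record { Represents ρ ; writer-pc = cong (next writer) (Represents.writer-pc ρ)
             ; writer-buffer = enqueue (index _) (λ ()) (Represents.writer-buffer ρ) } ,
      safe-S₁ (state c g) σ , history-skip refl η
    -- No second value of `latest` can be queued: the first Writer fence drained the previous one.
    writer-write record { w = T₁ ; buffered = just _ } refl ρ σ η
      with () ← Safe.drained σ tt
    writer-write g@record { k = k ; w = T₁ ; buffered = nothing } refl ρ σ η =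
      record { Ghost g ; w = P₁ ; k = suc k ; buffered = just (fwp (local c writer)) } ,
      record { Represents ρ ; writer-pc = cong (next writer) (Represents.writer-pc ρ)
             ; writer-buffer = wb } ,
      safe-T₁ (state c g) σ , history-skip refl η
      where
      wb : ∀ x → update _≟ᵛ_ (buffer c writer) latest (buffer c writer latest ∷ʳ fwp (local c writer)) x
           ≡ writerBuffer (just (fwp (local c writer))) nothing x
      wb latest       = cong (_∷ʳ _) (Represents.writer-buffer ρ latest)
      wb x@reading    = Represents.writer-buffer ρ x
      wb x@(index _)  = Represents.writer-buffer ρ x
      wb x@(slot _ _) = Represents.writer-buffer ρ x

    writer-fence : ∀ g → instr writer (Ghost.k g , writerPoint (Ghost.w g)) ≡ fence →
      (∀ x → buffer c writer x ≡ []) →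
      Preserved g (fenceᵉ writer (pc c writer)) (record c { pc = advance c writer })
    writer-fence g@record { w = slotBuffered } refl empty ρ σ η =
      ⊥-elim (only-nonempty (slot (fwp (local c writer)) (fwindex (local c writer)))
        (trans (sym (Represents.writer-buffer ρ (slot _ _))) (empty (slot _ _))))
    -- The fence also waits for the `latest` of the previous invocation; this is the source of
    -- `drained`.
    writer-fence g@record { w = slotStored ; buffered = just _ } refl empty ρ σ η
      with () ← trans (sym (Represents.writer-buffer ρ latest)) (empty latest)
    writer-fence g@record { w = slotStored ; buffered = nothing } refl empty ρ σ η =
      record { Ghost g ; w = S₁ } ,
      record { Represents ρ ; writer-pc = cong (next writer) (Represents.writer-pc ρ) } ,
      safe-fence-R₁S₁ (state c g) σ , history-skip refl η
    writer-fence g@record { w = indexBuffered } refl empty ρ σ η =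
      ⊥-elim (only-nonempty (index (fwp (local c writer)))
        (trans (sym (Represents.writer-buffer ρ (index _))) (empty (index _))))
    writer-fence g@record { w = indexStored } refl empty ρ σ η =
      record { Ghost g ; w = T₁ } ,
      record { Represents ρ ; writer-pc = cong (next writer) (Represents.writer-pc ρ) } ,
      safe-fence-S₁T₁ (state c g) σ , history-skip refl η

    writer-flush : ∀ g x {v vs} → buffer c writer x ≡ v ∷ vs →
      Preserved g (flushᵉ writer x v)
        (record c { store = update _≟ᵛ_ (store c) x v ; buffer = setBuffer c writer x vs })
    writer-flush g@record { w = w ; buffered = m } latest eq ρ σ η
      with m | trans (sym (Represents.writer-buffer ρ latest)) eq
    ... | just b | refl =
      record { Ghost g ; buffered = nothing } ,
      record { Represents ρ ; writer-buffer = dequeue-latest (Represents.writer-buffer ρ) } ,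
      safe-flush-latest (state c g) σ , history-skip refl η
    writer-flush g@record { k = k ; w = w ; stamp = stamp } (slot a b) eq ρ σ η
      with refl ← slot-pending w (trans (sym (Represents.writer-buffer ρ (slot a b))) eq)
      -- For any slot other than the chosen one, the second equation would equate an empty buffer
      -- with `v ∷ vs`.
      with slot (fwp (local c writer)) (fwindex (local c writer)) ≟ᵛ slot a b
         | trans (sym (Represents.writer-buffer ρ (slot a b))) eq
    ... | yes refl | refl =
      record { Ghost g ; w = slotStored ; stamp = restamp (slot a b) k stamp } ,
      record { Represents ρ
             ; writer-buffer = dequeue (slot a b) (λ ()) (Represents.writer-buffer ρ)
             ; stamped = stamped′ } ,
      safe-flush-slot (state c g) (restamp-at stamp a b) restamp-elsewhere σ , history-skip refl η
      where
      stamped′ : ∀ i j → update _≟ᵛ_ (store c) (slot a b) (D k) (slot i j) ≡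
        D (restamp (slot a b) k stamp i j)
      stamped′ i j with slot a b ≟ᵛ slot i j
      ... | yes refl = refl
      ... | no _     = Represents.stamped ρ i j
    writer-flush g@record { w = w } (index b) eq ρ σ η
      with refl ← index-pending w (trans (sym (Represents.writer-buffer ρ (index b))) eq)
      with index (fwp (local c writer)) ≟ᵛ index b
         | trans (sym (Represents.writer-buffer ρ (index b))) eq
    ... | yes refl | refl =
      record { Ghost g ; w = indexStored } ,
      record { Represents ρ
             ; writer-buffer = dequeue (index b) (λ ()) (Represents.writer-buffer ρ) } ,
      safe-flush-index (state c g) (update-at (index b)) (λ _ → update-elsewhere) σ ,
      history-skip refl η
    writer-flush g@record { w = w } reading eq ρ σ η =
      ⊥-elim (reading-unwritten w (trans (sym (Represents.writer-buffer ρ reading)) eq))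

    reader-read : Injective _≡_ _≡_ D →
      ∀ g {x f} → instr reader (Ghost.i g , readerPoint (Ghost.r g)) ≡ read x f →
      let y = x (local c reader) ; v = visible c reader y in
      Preserved g (readᵉ reader (pc c reader) y v)
        (record c { local = setLocal c reader (f (local c reader) v) ; pc = advance c reader })
    reader-read _ g@record { r = P₂ } refl ρ σ η
      rewrite visible-flushed reader latest (Represents.reader-buffer ρ latest) =
      record { Ghost g ; r = Q₂ } ,
      record { Represents ρ ; reader-pc = cong (next reader) (Represents.reader-pc ρ) } ,
      safe-P₂ (state c g) σ , history-skip refl η
    reader-read _ g@record { r = R₂ } refl ρ σ η
      rewrite visible-flushed reader (index (srp (local c reader)))
                (Represents.reader-buffer ρ (index (srp (local c reader)))) =
      record { Ghost g ; r = S₂ } ,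
      record { Represents ρ ; reader-pc = cong (next reader) (Represents.reader-pc ρ) } ,
      safe-R₂ (state c g) σ , history-skip refl η
    reader-read D-inj g@record { i = i ; r = S₂ ; stamp = stamp } refl ρ σ η
      rewrite visible-flushed reader (slot (srp (local c reader)) (srindex (local c reader)))
                (Represents.reader-buffer ρ (slot (srp (local c reader)) (srindex (local c reader)))) =
      record { Ghost g ; r = P₂ ; i = suc i
             ; n = stamp (srp (local c reader)) (srindex (local c reader)) } ,
      record { Represents ρ ; reader-pc = cong (next reader) (Represents.reader-pc ρ) } ,
      safe-S₂ (state c g) σ ,
      history-read D-inj
        (cong₂ (λ l d → just (l , d)) (Represents.reader-pc ρ) (Represents.stamped ρ _ _))
        -- At `S₂` the floor is the stamp of the very slot being read.
        (Safe.above σ) η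

    reader-write : ∀ g {x e} → instr reader (Ghost.i g , readerPoint (Ghost.r g)) ≡ write x e →
      let y = x (local c reader) ; v = e (local c reader) in
      Preserved g (writeᵉ reader (pc c reader) y v)
        (record c { buffer = setBuffer c reader y (buffer c reader y ∷ʳ v) ; pc = advance c reader })
    reader-write g@record { r = Q₂ } refl ρ σ η =
      record { Ghost g ; r = readingBuffered } ,
      record { Represents ρ
             ; reader-pc = cong (next reader) (Represents.reader-pc ρ)
             ; reader-buffer = λ x → update-cong reading x
                 (cong (_∷ʳ _) (Represents.reader-buffer ρ reading)) (Represents.reader-buffer ρ x) } ,
      safe-Q₂ (state c g) σ , history-skip refl η

    reader-fence : ∀ g → instr reader (Ghost.i g , readerPoint (Ghost.r g)) ≡ fence →
      (∀ x → buffer c reader x ≡ []) →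
      Preserved g (fenceᵉ reader (pc c reader)) (record c { pc = advance c reader })
    reader-fence record { r = readingBuffered } refl empty ρ σ η
      with () ← trans (sym (Represents.reader-buffer ρ reading)) (empty reading)
    reader-fence g@record { r = readingStored } refl empty ρ σ η =
      record { Ghost g ; r = R₂ } ,
      record { Represents ρ ; reader-pc = cong (next reader) (Represents.reader-pc ρ) } ,
      safe-fence-Q₂R₂ (state c g) σ , history-skip refl η

    reader-flush : ∀ g x {v vs} → buffer c reader x ≡ v ∷ vs →
      Preserved g (flushᵉ reader x v)
        (record c { store = update _≟ᵛ_ (store c) x v ; buffer = setBuffer c reader x vs })
    reader-flush g@record { r = r } x eq ρ σ η
      with refl , refl ← reader-pending r x (trans (sym (Represents.reader-buffer ρ x)) eq)
      with refl ← trans (sym (Represents.reader-buffer ρ reading)) eq =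
      record { Ghost g ; r = readingStored } ,
      record { Represents ρ
             ; reader-buffer = λ y → only-drained reading y (Represents.reader-buffer ρ y) } ,
      safe-flush-reading (state c g) σ , history-skip refl η

    preserve : Injective _≡_ _≡_ D → ∀ {ev c′} → c ─[ ev ]→ c′ →
      Invariant tr c → Invariant (ev ∷ tr) c′
    preserve D-inj (read-step writer eq) (g , ρ , σ , η) =
      writer-read g (subst (λ l → instr writer l ≡ _) (Represents.writer-pc ρ) eq) ρ σ η
    preserve D-inj (read-step reader eq) (g , ρ , σ , η) =
      reader-read D-inj g (subst (λ l → instr reader l ≡ _) (Represents.reader-pc ρ) eq) ρ σ η
    preserve D-inj (write-step writer eq) (g , ρ , σ , η) =
      writer-write g (subst (λ l → instr writer l ≡ _) (Represents.writer-pc ρ) eq) ρ σ η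
    preserve D-inj (write-step reader eq) (g , ρ , σ , η) =
      reader-write g (subst (λ l → instr reader l ≡ _) (Represents.reader-pc ρ) eq) ρ σ η
    preserve D-inj (fence-step writer eq empty) (g , ρ , σ , η) =
      writer-fence g (subst (λ l → instr writer l ≡ _) (Represents.writer-pc ρ) eq) empty ρ σ η
    preserve D-inj (fence-step reader eq empty) (g , ρ , σ , η) =
      reader-fence g (subst (λ l → instr reader l ≡ _) (Represents.reader-pc ρ) eq) empty ρ σ η
    preserve D-inj (assign-step writer eq) (g , ρ , _) =
      ⊥-elim (writer-assigns-nothing (Ghost.w g)
        (subst (λ l → instr writer l ≡ _) (Represents.writer-pc ρ) eq))
    preserve D-inj (assign-step reader eq) (g , ρ , _) =
      ⊥-elim (reader-assigns-nothing (Ghost.r g)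
        (subst (λ l → instr reader l ≡ _) (Represents.reader-pc ρ) eq))
    preserve D-inj (flush-step writer x eq) (g , ρ , σ , η) = writer-flush g x eq ρ σ η
    preserve D-inj (flush-step reader x eq) (g , ρ , σ , η) = reader-flush g x eq ρ σ η

  -- Induction over executions and the two properties.

  invariant : Injective _≡_ _≡_ D → ∀ {w₀ r₀ tr c} →
    Execution (initial w₀ r₀) tr c → Invariant tr c
  invariant D-inj {w₀} {r₀} start =
    g , represents , safe , record { past = λ () ; recent = λ () ; ordered = λ () }
    where
    g : Ghost
    -- Every slot holds `D 0`, hence all stamps are 0; `n = 0` is the trivial bound before any read.
    g = record { k = 1 ; i = 1 ; n = 0 ; w = P₁ ; r = P₂ ; buffered = nothing ; stamp = λ _ _ → 0 }
    empty : ∀ x → [] ≡ writerBuffer nothing nothing x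
    empty reading    = refl
    empty latest     = refl
    empty (index _)  = refl
    empty (slot _ _) = refl
    represents : Represents (initial w₀ r₀) g
    represents = record
      { writer-pc     = refl
      ; reader-pc     = refl
      ; writer-buffer = empty
      ; reader-buffer = λ _ → refl
      ; stamped       = λ _ _ → refl
      }
    safe : Safe (state (initial w₀ r₀) g)
    safe = record
      { bounded   = λ _ → z≤n
      ; progress  = tt
      ; drained   = λ ()
      ; newest    = λ ()
      ; lag       = inj₁ z≤n
      ; held      = λ { (inj₁ ()) }
      ; aligned   = λ ()
      ; announced = λ ()
      ; synced    = λ ()
      ; above     = z≤n
      ; settled   = λ ()
      ; disjoint  = λ ()
      }
  invariant D-inj (e ▷ step) = preserve D-inj step (invariant D-inj e)

  at-R₁ : ∀ {k l} w → _≡_ {A = Label writer} (k , writerPoint w) (l , R₁) → w ≡ R₁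
  at-R₁ R₁ _ = refl

  at-S₂ : ∀ {i j} r → _≡_ {A = Label reader} (i , readerPoint r) (j , S₂) → r ≡ S₂
  at-S₂ S₂ _ = refl

  interference-free : ∀ {tr c k r} → Invariant tr c →
    pc c writer ≡ (k , R₁) → pc c reader ≡ (r , S₂) →
    fwp (local c writer) ≢ srp (local c reader) ⊎
    (fwp (local c writer) ≡ srp (local c reader) ×
     fwindex (local c writer) ≢ srindex (local c reader))
  interference-free {c = c} (record { w = w ; r = r } , ρ , σ , _) w-pc r-pc
    with refl ← at-R₁ w (trans (sym (Represents.writer-pc ρ)) w-pc)
    with refl ← at-S₂ r (trans (sym (Represents.reader-pc ρ)) r-pc)
    with fwp (local c writer) Bool.≟ srp (local c reader)
  ... | no p≢  = inj₁ p≢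
  -- In a common pair `disjoint` makes `srindex` the current index, and `progress` makes `fwindex`
  -- its negation.
  ... | yes p≡ = inj₂ (p≡ , λ q≡ →
    Bool.not-¬ (trans (Safe.disjoint σ refl tt p≡) (cong (λ b → store c (index b)) (sym p≡)))
      (trans (sym q≡) (Safe.progress σ)))

mainTheorem1 : (Datum : Set) (D : ℕ → Datum) → Injective _≡_ _≡_ D →
    (w₀ : WriterLocal) (r₀ : ReaderLocal) →
    let open Simpson Datum D in
    ( ∀ (c : Config) (k r : ℕ) → Reachable (initial w₀ r₀) c →
    pc c writer ≡ (k , R₁) → pc c reader ≡ (r , S₂) →
    fwp (local c writer) ≢ srp (local c reader) ⊎
    (fwp (local c writer) ≡ srp (local c reader) ×
    fwindex (local c writer) ≢ srindex (local c reader)) )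
    ×
    ( ∀ (tr : List Event) (c : Config) → Execution (initial w₀ r₀) tr c →
    ∀ (i k₁ k₂ : ℕ) →
    InvocationReads tr i (D k₁) → InvocationReads tr (suc i) (D k₂) →
    k₁ ≤ k₂ )
mainTheorem1 Datum D D-inj w₀ r₀ =
  (λ _ _ _ (_ , e) → interference-free (invariant D-inj e)) ,
  (λ _ _ e _ _ _ → let (_ , _ , _ , η) = invariant D-inj e in History.ordered η)
  where open Simulation D
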